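{- Let $k\in\mathbb{N}$, let $1\le p<\infty$, and let $(\mu_i)_{i\in\mathbb{N}}$ be a sequence of positive real numbers with $\sum_{i=1}^\infty \mu_i^p<\infty$. Let $\overline{V^{\otimes k}}=L^p(\mathbb{N}^k,\mu^k)$ be the associated weighted sequence space with the diagonal action of the infinite symmetric group $S_\infty$. Then the vector space $(\overline{V^{\otimes k}})^{S_\infty}$ of $S_\infty$-invariant vectors has $\{m_\pi \mid \pi \text{ a set partition of } \{1,\dots,k\}\}$ as a basis.
   Context: $\mathbb{N}=\{1,2,\dots\}$. $S_\infty$ is the group of permutations of $\mathbb{N}$ that fix all but finitely many elements. For $\mathbf{i}=(i_1,\dots,i_k)\in\mathbb{N}^k$ put $\mu_{\mathbf{i}}=\prod_{\ell=1}^k\mu_{i_\ell}$ and, for $\sigma\in S_\infty$, $\sigma(\mathbf{i})=(\sigma(i_1),\dots,\sigma(i_k))$. The space is $$\overline{V^{\otimes k}}=L^p(\mathbb{N}^k,\mu^k)=\Bigl\{v=(a_{\mathbf{i}})_{\mathbf{i}\in\mathbb{N}^k}\in\mathbb{C}^{\mathbb{N}^k}\ \Big|\ \|v\|^p=\sum_{\mathbf{i}\in\mathbb{N}^k}|a_{\mathbf{i}}|^p\mu_{\mathbf{i}}^p<\infty\Bigr\},$$ a Banach space which is the completion, for a canonical cross norm, of the $k$-fold algebraic tensor power of $V=L^p(\mathbb{N},\mu)=\{(a_i)_{i\in\mathbb{N}}\in\mathbb{C}^{\mathbb{N}}\mid \sum_i|a_i|^p\mu_i^p<\infty\}$. Write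 $v_{\mathbf{i}}\in\mathbb{C}^{\mathbb{N}^k}$ for the indicator function of $\mathbf{i}$, and write $\sum_{\mathbf{i}\in\mathbb{N}^k}a_{\mathbf{i}}v_{\mathbf{i}}$ for the function $\mathbf{i}\mapsto a_{\mathbf{i}}$ in $\mathbb{C}^{\mathbb{N}^k}$. The action of $\sigma\in S_\infty$ is $\sigma\cdot (a_{\mathbf{i}})_{\mathbf{i}}=(a_{\sigma^{ -1}(\mathbf{i})})_{\mathbf{i}}$, so that $\sigma\cdot v_{\mathbf{i}}=v_{\sigma(\mathbf{i})}$. For a set partition $\pi$ of $\{1,\dots,k\}$, $m_\pi=\sum_{\mathbf{i}\in\mathbb{N}^k}\pi_{\mathbf{i}}v_{\mathbf{i}}\in\mathbb{C}^{\mathbb{N}^k}$, where $\pi_{(i_1,\dots,i_k)}=1$ if $i_\ell=i_m$ whenever $\ell$ and $m$ are in the same block of $\pi$, and $\pi_{(i_1,\dots,i_k)}=0$ otherwise. (Part of the claim is that each $m_\pi$ lies in $\overline{V^{\otimes k}}$.) -}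

module Defs where

open import Algebra.Apartness.Bundles using (HeytingField; HeytingCommutativeRing)
open import Algebra.Bundles using (AbelianGroup; CommutativeRing)
import Algebra.Construct.DirectProduct as DirectProduct
import Algebra.Construct.Pointwise as Pointwise
open import Algebra.Module.Bundles using (Module)
open import Algebra.Module.Structures.Biased using (IsModuleFromLeft)
import Algebra.Properties.CommutativeMonoid.Sum as Sum
import Algebra.Consequences.Setoid as Consequences
import Algebra.Properties.Monoid.Mult as Mult
import Algebra.Properties.Ring as RingProperties
import Algebra.Solver.Ring.NaturalCoefficients.Default as SemiringSolver
open import Data.Bool.Base using (Bool; T; if_then_else_)
open import Data.Bool.Properties using (T?)
open import Data.Fin.Base using (Fin)
open import Data.Fin.Properties using (all?)
open import Data.Fin.Subset using (Subset; Nonempty; _∈_)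
open import Data.Fin.Subset.Properties using (_∈?_; anySubset?)
open import Data.List.Base using (List)
open import Data.List.Membership.Propositional using (_∉_)
open import Data.Nat.Base as ℕ using (ℕ)
import Data.Nat.Properties as ℕ
open import Data.Product.Base using (_×_; _,_; ∃; ∃-syntax; Σ-syntax)
open import Data.Sum.Base using (_⊎_)
open import Data.Vec.Base using (Vec; lookup; map)
open import Function.Base using (_∘_)
open import Function.Bundles using (_↔_; Inverse)
open import Function.Definitions using (Injective)
open import Level using (Level; _⊔_; suc; 0ℓ)
open import Relation.Binary.Bundles using (Setoid)
open import Relation.Binary.Core using (Rel)
open import Relation.Binary.PropositionalEquality.Core as ≡ using (_≡_)
open import Relation.Binary.Structures using (IsStrictPartialOrder)
open import Relation.Nullary.Decidable using (Dec; does; _×-dec_; _→-dec_)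
open import Relation.Nullary.Negation using (¬_)
open import Relation.Unary using (Pred; _⊆_)

-- The real numbers, axiomatised as a Cauchy-complete Archimedean ordered
-- field; these axioms characterise ℝ up to isomorphism.  Square roots and
-- real powers exist and are unique in such a field, so the operations √ and
-- _^_ below are no extra structure: on the arguments to which their laws
-- apply, the laws determine them, and their other values are never used.

record RealNumbers c ℓ₁ ℓ₂ : Set (suc (c ⊔ ℓ₁ ⊔ ℓ₂)) where
  infix 4 _<_ _≤_
  infixr 8 _^_
  field
    heytingField : HeytingField c ℓ₁ ℓ₂

  open HeytingField heytingField public renaming (Carrier to ℝ)

  commutativeRing : CommutativeRing c ℓ₁
  commutativeRing = HeytingCommutativeRing.commutativeRing heytingCommutativeRing

  open CommutativeRing commutativeRing public
    using (+-monoid; +-abelianGroup; +-commutativeMonoid; *-commutativeMonoid)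

  open Mult +-monoid public using () renaming (_×_ to _·ℕ_)
  open Sum +-commutativeMonoid public using (sum)
  open Sum *-commutativeMonoid public using () renaming (sum to product)

  field
    _<_                  : Rel ℝ ℓ₂
    isStrictPartialOrder : IsStrictPartialOrder _≈_ _<_
    #⇒<⊎>                : ∀ {x y} → x # y → x < y ⊎ y < x
    <⇒#                  : ∀ {x y} → x < y → x # y
    +-monoˡ-<            : ∀ {x y} z → x < y → x + z < y + z
    *-pos                : ∀ {x y} → 0# < x → 0# < y → 0# < x * y
    archimedean          : ∀ x → ∃[ n ] x < n ·ℕ 1#

  _≤_ : Rel ℝ ℓ₂
  x ≤ y = ¬ (y < x)

  IsCauchy : (ℕ → ℝ) → Set (c ⊔ ℓ₂)
  IsCauchy s = ∀ ε → 0# < ε →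
    ∃[ N ] (∀ m n → N ℕ.≤ m → N ℕ.≤ n → s m < s n + ε)

  ConvergesTo : (ℕ → ℝ) → ℝ → Set (c ⊔ ℓ₂)
  ConvergesTo s x = ∀ ε → 0# < ε →
    ∃[ N ] (∀ n → N ℕ.≤ n → s n < x + ε × x < s n + ε)

  field
    complete : ∀ s → IsCauchy s → ∃ (ConvergesTo s)

    √        : ℝ → ℝ
    √-cong   : ∀ {x y} → x ≈ y → √ x ≈ √ y
    √-nonNeg : ∀ {x} → 0# ≤ x → 0# ≤ √ x
    √-square : ∀ {x} → 0# ≤ x → √ x * √ x ≈ x

    _^_          : ℝ → ℝ → ℝ
    ^-cong       : ∀ {x y p q} → x ≈ y → p ≈ q → x ^ p ≈ y ^ q
    ^-identityʳ  : ∀ {x} → 0# ≤ x → x ^ 1# ≈ x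
    ^-distribˡ-+ : ∀ {x p q} → 0# ≤ x → 1# ≤ p → 1# ≤ q →
                   x ^ (p + q) ≈ x ^ p * x ^ q
    ^-distribʳ-* : ∀ {x y p} → 0# ≤ x → 0# ≤ y → 1# ≤ p →
                   (x * y) ^ p ≈ x ^ p * y ^ p
    ^-monoˡ-≤    : ∀ {x y p} → 0# ≤ x → x ≤ y → 1# ≤ p → x ^ p ≤ y ^ p
    ^-monoʳ-≤    : ∀ {x p q} → 1# ≤ x → 1# ≤ p → p ≤ q → x ^ p ≤ x ^ q

  -- ∑ f < ∞ for a family f of non-negative reals: the sums over finite sets
  -- of indices (listed without repetition) have a common upper bound.
  Summable : ∀ {a} {A : Set a} → (A → ℝ) → Set (a ⊔ c ⊔ ℓ₂)
  Summable {A = A} f = ∃[ B ] (∀ {n} (x : Fin n → A) → Injective _≡_ _≡_ x →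
    sum (f ∘ x) ≤ B)

module Complex {c ℓ₁ ℓ₂} (R : RealNumbers c ℓ₁ ℓ₂) where
  open RealNumbers R

  infixl 7 _*ᶜ_

  ℂ : Set c
  ℂ = ℝ × ℝ

  private
    +ᶜ-abelianGroup : AbelianGroup c ℓ₁
    +ᶜ-abelianGroup = DirectProduct.abelianGroup +-abelianGroup +-abelianGroup

  open AbelianGroup +ᶜ-abelianGroup public using ()
    renaming (_≈_ to _≈ᶜ_; _∙_ to _+ᶜ_; ε to 0ᶜ; _⁻¹ to -ᶜ_)

  1ᶜ : ℂ
  1ᶜ = 1# , 0#

  _*ᶜ_ : ℂ → ℂ → ℂ
  (a , b) *ᶜ (a′ , b′) = (a * a′ - b * b′) , (a * b′ + b * a′)

  ∣_∣ : ℂ → ℝ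
  ∣ a , b ∣ = √ (a * a + b * b)

  private
    open SemiringSolver (CommutativeRing.commutativeSemiring commutativeRing)
      using (solve; _:=_; _:+_; _:*_)
    open RingProperties (CommutativeRing.ring commutativeRing)
      using (-1*x≈-x; -0#≈0#)

    -- With j = - 1# the ring laws below are commutative semiring identities.
    j : ℝ
    j = - 1#

    minus : ∀ x y → x - y ≈ x + j * y
    minus x y = +-congˡ (sym (-1*x≈-x y))

    *ᶜ-cong : ∀ {x x′ y y′} → x ≈ᶜ x′ → y ≈ᶜ y′ → x *ᶜ y ≈ᶜ x′ *ᶜ y′
    *ᶜ-cong (p , q) (r , s) =
      +-cong (*-cong p r) (-‿cong (*-cong q s)) ,
      +-cong (*-cong p s) (*-cong q r)

    *ᶜ-comm : ∀ x y → x *ᶜ y ≈ᶜ y *ᶜ x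
    *ᶜ-comm (a , b) (c , d) =
      +-cong (*-comm a c) (-‿cong (*-comm b d)) ,
      solve 4 (λ a b c d → a :* d :+ b :* c := c :* b :+ d :* a) refl a b c d

    *ᶜ-assoc : ∀ x y z → (x *ᶜ y) *ᶜ z ≈ᶜ x *ᶜ (y *ᶜ z)
    *ᶜ-assoc (a , b) (c , d) (e , f) =
      trans (trans (minus _ _) (+-congʳ (*-congʳ (minus _ _))))
        (trans
          (solve 7 (λ j a b c d e f →
              (a :* c :+ j :* (b :* d)) :* e :+ j :* ((a :* d :+ b :* c) :* f) :=
              a :* (c :* e :+ j :* (d :* f)) :+ j :* (b :* (c :* f :+ d :* e)))
            refl j a b c d e f)
          (sym (trans (minus _ _) (+-congʳ (*-congˡ (minus _ _)))))) ,
      trans (+-congʳ (*-congʳ (minus _ _)))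
        (trans
          (solve 7 (λ j a b c d e f →
              (a :* c :+ j :* (b :* d)) :* f :+ (a :* d :+ b :* c) :* e :=
              a :* (c :* f :+ d :* e) :+ b :* (c :* e :+ j :* (d :* f)))
            refl j a b c d e f)
          (sym (+-congˡ (*-congˡ (minus _ _)))))

    *ᶜ-identityˡ : ∀ x → 1ᶜ *ᶜ x ≈ᶜ x
    *ᶜ-identityˡ (a , b) =
      trans (+-cong (*-identityˡ a) (trans (-‿cong (zeroˡ b)) -0#≈0#)) (+-identityʳ a) ,
      trans (+-cong (*-identityˡ b) (zeroˡ a)) (+-identityʳ b)

    *ᶜ-distribˡ : ∀ x y z → x *ᶜ (y +ᶜ z) ≈ᶜ (x *ᶜ y) +ᶜ (x *ᶜ z)
    *ᶜ-distribˡ (a , b) (c , d) (e , f) =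
      trans (minus _ _)
        (trans
          (solve 7 (λ j a b c d e f →
              a :* (c :+ e) :+ j :* (b :* (d :+ f)) :=
              (a :* c :+ j :* (b :* d)) :+ (a :* e :+ j :* (b :* f)))
            refl j a b c d e f)
          (sym (+-cong (minus _ _) (minus _ _)))) ,
      solve 6 (λ a b c d e f →
          a :* (d :+ f) :+ b :* (c :+ e) :=
          (a :* d :+ b :* c) :+ (a :* f :+ b :* e))
        refl a b c d e f

  ℂ-commutativeRing : CommutativeRing c ℓ₁
  ℂ-commutativeRing = record
    { Carrier = ℂ
    ; _≈_     = _≈ᶜ_
    ; _+_     = _+ᶜ_
    ; _*_     = _*ᶜ_
    ; -_      = -ᶜ_
    ; 0#      = 0ᶜ
    ; 1#      = 1ᶜ
    ; isCommutativeRing = record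
      { isRing = record
        { +-isAbelianGroup = AbelianGroup.isAbelianGroup +ᶜ-abelianGroup
        ; *-cong     = *ᶜ-cong
        ; *-assoc    = *ᶜ-assoc
        ; *-identity = *ᶜ-identityˡ , comm∧idˡ⇒idʳ *ᶜ-comm *ᶜ-identityˡ
        ; distrib    = *ᶜ-distribˡ , comm∧distrˡ⇒distrʳ ∙-cong *ᶜ-comm *ᶜ-distribˡ
        }
      ; *-comm = *ᶜ-comm
      }
    }
    where
    open AbelianGroup +ᶜ-abelianGroup using (∙-cong) renaming (setoid to ≈ᶜ-setoid)
    open Consequences ≈ᶜ-setoid using (comm∧idˡ⇒idʳ; comm∧distrˡ⇒distrʳ)

-- The module K^A of all functions A → K with pointwise operations.

functionModule : ∀ {a r ℓ} (K : CommutativeRing r ℓ) (A : Set a) → Module K (a ⊔ r) (a ⊔ ℓ)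
functionModule K A = record
  { isModule = IsModuleFromLeft.isModule (record
    { isLeftModule = record
      { isLeftSemimodule = record
        { +ᴹ-isCommutativeMonoid = +ᴬ.isCommutativeMonoid
        ; isPreleftSemimodule = record
          { *ₗ-cong      = λ k≈l f≈g i → *-cong k≈l (f≈g i)
          ; *ₗ-zeroˡ     = λ f i → zeroˡ (f i)
          ; *ₗ-distribʳ  = λ f k l i → distribʳ (f i) k l
          ; *ₗ-identityˡ = λ f i → *-identityˡ (f i)
          ; *ₗ-assoc     = λ k l f i → *-assoc k l (f i)
          ; *ₗ-zeroʳ     = λ k i → zeroʳ k
          ; *ₗ-distribˡ  = λ k f g i → distribˡ k (f i) (g i)
          }
        }
      ; -ᴹ‿cong    = +ᴬ.⁻¹-cong
      ; -ᴹ‿inverse = +ᴬ.inverse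
      }
    })
  }
  where
  open CommutativeRing K
  module +ᴬ = AbelianGroup (Pointwise.abelianGroup A +-abelianGroup)

-- Bases, in the sense of finite linear combinations, of a subspace W.  The
-- family b is indexed by a setoid; in the independence condition the indices
-- i 0, …, i (n - 1) are pairwise distinct.

module Bases {r ℓ m ℓm} {K : CommutativeRing r ℓ} (M : Module K m ℓm) where
  open CommutativeRing K using (_≈_; 0#) renaming (Carrier to Scalar)
  open Module M
  open Sum +ᴹ-commutativeMonoid using (sum)

  module _ {i ℓi} (I : Setoid i ℓi) (b : Setoid.Carrier I → Carrierᴹ) where
    open Setoid I using () renaming (Carrier to Index; _≈_ to _≈ᴵ_)

    LinearlyIndependent : Set _
    LinearlyIndependent =
      ∀ {n} (i : Fin n → Index) → Injective _≡_ _≈ᴵ_ i →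
      ∀ (k : Fin n → Scalar) →
      sum (λ s → k s *ₗ b (i s)) ≈ᴹ 0ᴹ → ∀ s → k s ≈ 0#

    Span : Pred Carrierᴹ _
    Span w = ∃[ n ] Σ[ i ∈ (Fin n → Index) ] Σ[ k ∈ (Fin n → Scalar) ]
      w ≈ᴹ sum (λ s → k s *ₗ b (i s))

    record IsBasisOf {w} (W : Pred Carrierᴹ w) : Set (r ⊔ ℓ ⊔ m ⊔ ℓm ⊔ i ⊔ ℓi ⊔ w) where
      field
        member              : ∀ i → W (b i)
        linearlyIndependent : LinearlyIndependent
        spanning            : W ⊆ Span

-- Set partitions of Fin k: sets of non-empty subsets (the blocks) such that
-- every element lies in exactly one of them.  As a set of subsets of a finite
-- set, the set of blocks is given by its Boolean characteristic function.

record SetPartition (k : ℕ) : Set where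
  field
    isBlock : Subset k → Bool

  Block : Pred (Subset k) 0ℓ
  Block B = T (isBlock B)

  field
    nonempty : ∀ {B} → Block B → Nonempty B
    covers   : ∀ x → ∃[ B ] (Block B × x ∈ B)
    disjoint : ∀ {B C x} → Block B → Block C → x ∈ B → x ∈ C → B ≡ C

  SameBlock : Rel (Fin k) 0ℓ
  SameBlock x y = ∃[ B ] (Block B × x ∈ B × y ∈ B)

  sameBlock? : ∀ x y → Dec (SameBlock x y)
  sameBlock? x y = anySubset? λ B → T? (isBlock B) ×-dec x ∈? B ×-dec y ∈? B

setPartitions : ℕ → Setoid 0ℓ 0ℓ
setPartitions k = record
  { Carrier       = SetPartition k
  ; _≈_           = λ π ρ → ∀ B → isBlock π B ≡ isBlock ρ B
  ; isEquivalence = record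
    { refl  = λ _ → ≡.refl
    ; sym   = λ p B → ≡.sym (p B)
    ; trans = λ p q B → ≡.trans (p B) (q B)
    }
  }
  where open SetPartition

-- Finitely supported permutations of ℕ; numbering from 0 rather than from 1
-- only relabels the index set.

record S∞ : Set where
  field
    permutation   : ℕ ↔ ℕ

  open Inverse permutation public using (to; from)

  field
    finiteSupport : Σ[ xs ∈ List ℕ ] (∀ n → n ∉ xs → to n ≡ n)

module TensorPower {c ℓ₁ ℓ₂} (R : RealNumbers c ℓ₁ ℓ₂) (k : ℕ) where
  open RealNumbers R
  open Complex R

  ℂ^ℕᵏ : Module ℂ-commutativeRing c ℓ₁
  ℂ^ℕᵏ = functionModule ℂ-commutativeRing (Vec ℕ k)

  open Module ℂ^ℕᵏ public using (Carrierᴹ; _≈ᴹ_)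

  -- Product weight, written μ with a multi-index subscript.
  weight : (ℕ → ℝ) → Vec ℕ k → ℝ
  weight μ 𝐢 = product (λ l → μ (lookup 𝐢 l))

  Lᵖ : ℝ → (ℕ → ℝ) → Pred Carrierᴹ (c ⊔ ℓ₂)
  Lᵖ p μ a = Summable (λ 𝐢 → ∣ a 𝐢 ∣ ^ p * weight μ 𝐢 ^ p)

  infixr 7 _•_
  _•_ : S∞ → Carrierᴹ → Carrierᴹ
  (σ • a) 𝐢 = a (map (S∞.from σ) 𝐢)

  LᵖInvariants : ℝ → (ℕ → ℝ) → Pred Carrierᴹ (c ⊔ ℓ₁ ⊔ ℓ₂)
  LᵖInvariants p μ a = Lᵖ p μ a × (∀ σ → σ • a ≈ᴹ a)

  ConstantOnBlocks : SetPartition k → Pred (Vec ℕ k) 0ℓ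
  ConstantOnBlocks π 𝐢 = ∀ l m → SetPartition.SameBlock π l m → lookup 𝐢 l ≡ lookup 𝐢 m

  constantOnBlocks? : ∀ π 𝐢 → Dec (ConstantOnBlocks π 𝐢)
  constantOnBlocks? π 𝐢 = all? λ l → all? λ m →
    SetPartition.sameBlock? π l m →-dec (lookup 𝐢 l ℕ.≟ lookup 𝐢 m)

  m[_] : SetPartition k → Carrierᴹ
  m[ π ] 𝐢 = if does (constantOnBlocks? π 𝐢) then 1ᶜ else 0ᶜ

{-# OPTIONS --safe #-}

-- The orbits of S∞ on ℕᵏ are the classes of tuples with the same level sets,
-- so they correspond to set partitions of the positions, and m[ π ] is the
-- indicator function of the orbits whose partition is coarser than π.  The
-- incidence matrix of refinement is unitriangular for any linear extension of
-- the refinement order; this gives independence and spanning, already in the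
-- space of all functions.  Integrability of m[ π ] follows from
-- ∑ (μ_𝐢)^p = (∑ μ_i^p)^k, the sum on the left being over all 𝐢 in ℕᵏ.

module Submission where

open import Defs
open import Algebra.Bundles using (CommutativeRing)
import Algebra.Apartness.Properties.HeytingCommutativeRing as HeytingProperties
open import Algebra.Module.Bundles using (Module)
import Algebra.Properties.CommutativeMonoid.Sum as Sum
import Algebra.Properties.Ring as RingProperties
import Algebra.Properties.Semiring.Sum as SemiringSum
open import Data.Bool.Base using (Bool; true; false; if_then_else_)
open import Data.Bool.Properties as Bool using (T-≡; ⇔→≡)
open import Data.Fin.Base as Fin using (Fin; zero; suc; toℕ; fromℕ<; _↑ˡ_; _↑ʳ_; combine; quotient; remainder; finToFun; funToFin; punchOut)
open import Data.Fin.Properties using (2↔Bool; any?; 0≢1+n; suc-injective; toℕ-injective; toℕ<n; toℕ-fromℕ<; toℕ-combine; combine-monoˡ-<; combine-injective; combine-remQuot; remQuot-combine; finToFun-funToFin; punchOut-injective; punchIn-punchOut; punchInᵢ≢i)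
open import Data.Fin.Subset using (Subset; _∈_; _⊆_)
open import Data.Fin.Subset.Properties using (⊆-antisym; drop-∷-⊆)
open import Data.List.Base using ([]; _∷_; _++_)
open import Data.List.Membership.Propositional.Properties using (∈-++⁺ˡ; ∈-++⁺ʳ)
open import Data.List.Relation.Unary.Any using (here; there)
open import Data.Nat.Base as ℕ using (ℕ; zero; suc; NonZero)
open import Data.Nat.Induction using (<-wellFounded)
import Data.Nat.Properties as ℕ
open import Data.Product.Base using (_,_; proj₁; proj₂; ∃-syntax)
open import Data.Sum.Base using (inj₁; inj₂; [_,_])
open import Data.Vec.Base as Vec using (Vec; []; _∷_; lookup; tabulate; here)
open import Data.Vec.Functional using (removeAt) renaming (_∷_ to _∷ᶠ_)
open import Data.Vec.Properties using ([]=⇒lookup; lookup⇒[]=; lookup∘tabulate; tabulate∘lookup; tabulate-cong; lookup-map; ≡-dec)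
open import Function.Base using (_∘_)
open import Function.Bundles using (_↔_; mk⇔; mk↔ₛ′; Equivalence; Inverse; Injection)
open import Function.Construct.Composition using (_↔-∘_)
open import Function.Construct.Identity using (↔-id)
open import Function.Definitions using (Injective)
open import Function.Properties.Inverse using (↔⇒↣; ↔-sym)
open import Induction.WellFounded using (Acc; acc)
open import Relation.Binary.Bundles using (Preorder)
open import Relation.Binary.PropositionalEquality as ≡ using (_≡_; _≢_)
import Relation.Binary.Reasoning.Preorder as PreorderReasoning
import Relation.Binary.Reasoning.Setoid as SetoidReasoning
open import Relation.Binary.Structures using (IsStrictPartialOrder)
open import Relation.Nullary.Decidable using (Dec; yes; no; does; dec-true; does-⇔; toWitness; fromWitness; ⌊_⌋)
open import Relation.Nullary.Negation using (¬_; contradiction)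

-- Order and powers in the axiomatised reals.

module RealProperties {c ℓ₁ ℓ₂} (R : RealNumbers c ℓ₁ ℓ₂) where
  open RealNumbers R hiding (zero)
  private
    module CR = CommutativeRing commutativeRing
    module < = IsStrictPartialOrder isStrictPartialOrder
    module ∑ = Sum CR.+-commutativeMonoid
  open RingProperties CR.ring using (-‿distribˡ-*; -‿distribʳ-*; -‿involutive)
  open HeytingProperties heytingCommutativeRing using (1#0)
  open SemiringSum CR.semiring using (*-distribˡ-sum; *-distribʳ-sum)

  ≤-reflexive : ∀ {x y} → x ≈ y → x ≤ y
  ≤-reflexive x≈y = <.irrefl (sym x≈y)

  -- `x ≤ y` is the negation of `y < x`, so transitivity rests on cotransitivity of apartness: from
  -- `z < x` the middle point `y` is apart from `z` or from `x`, and every resulting order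
  -- contradicts a hypothesis.
  ≤-trans : ∀ {x y z} → x ≤ y → y ≤ z → x ≤ z
  ≤-trans {x} {y} {z} x≤y y≤z z<x with #-cotrans (<⇒# z<x) y
  ... | inj₁ z#y with #⇒<⊎> z#y
  ...   | inj₁ z<y = y≤z z<y
  ...   | inj₂ y<z = x≤y (<.trans y<z z<x)
  ≤-trans {x} {y} {z} x≤y y≤z z<x | inj₂ y#x with #⇒<⊎> y#x
  ...   | inj₁ y<x = x≤y y<x
  ...   | inj₂ x<y = y≤z (<.trans z<x x<y)

  ≤-antisym : ∀ {x y} → x ≤ y → y ≤ x → x ≈ y
  ≤-antisym {x} {y} x≤y y≤x = proj₁ (tight x y) ([ y≤x , x≤y ] ∘ #⇒<⊎>)

  ≤-preorder : Preorder c ℓ₁ ℓ₂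
  ≤-preorder = record
    { _≲_ = _≤_
    ; isPreorder = record { isEquivalence = isEquivalence ; reflexive = ≤-reflexive ; trans = ≤-trans }
    }

  open PreorderReasoning ≤-preorder

  x<y⇒0<y-x : ∀ {x y} → x < y → 0# < y - x
  x<y⇒0<y-x {x} x<y = <.<-respˡ-≈ (-‿inverseʳ x) (+-monoˡ-< (- x) x<y)

  0<y-x⇒x<y : ∀ {x y} → 0# < y - x → x < y
  0<y-x⇒x<y {x} {y} 0<y-x =
    <.<-respˡ-≈ (+-identityˡ x)
      (<.<-respʳ-≈ (trans (+-assoc y (- x) x) (trans (+-congˡ (-‿inverseˡ x)) (+-identityʳ y)))
        (+-monoˡ-< x 0<y-x))

  x<0⇒0<-x : ∀ {x} → x < 0# → 0# < - x
  x<0⇒0<-x {x} x<0 = <.<-respʳ-≈ (+-identityˡ (- x)) (x<y⇒0<y-x x<0)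

  +-monoˡ-≤ : ∀ {x y} z → x ≤ y → x + z ≤ y + z
  +-monoˡ-≤ {x} {y} z x≤y y+z<x+z =
    x≤y (<.<-respˡ-≈ (cancel y) (<.<-respʳ-≈ (cancel x) (+-monoˡ-< (- z) y+z<x+z)))
    where
    cancel : ∀ w → w + z - z ≈ w
    cancel w = trans (+-assoc w z (- z)) (trans (+-congˡ (-‿inverseʳ z)) (+-identityʳ w))

  +-mono-≤ : ∀ {w x y z} → w ≤ x → y ≤ z → w + y ≤ x + z
  +-mono-≤ {w} {x} {y} {z} w≤x y≤z = begin
    w + y ≲⟨ +-monoˡ-≤ y w≤x ⟩
    x + y ≈⟨ +-comm x y ⟩
    y + x ≲⟨ +-monoˡ-≤ x y≤z ⟩
    z + x ≈⟨ +-comm z x ⟩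
    x + z ∎

  -- The sign of `z` cannot be decided. If the claim fails then `(x - y) * z` is positive although
  -- `x - y ≤ 0#`. A positive `z` would force `x - y ≈ 0#`, which is absurd; hence `z ≈ 0#`, which
  -- is absurd as well.
  *-monoˡ-≤ : ∀ {x y z} → 0# ≤ z → x ≤ y → x * z ≤ y * z
  *-monoˡ-≤ {x} {y} {z} 0≤z x≤y yz<xz =
    ≉0 (*-congˡ (≤-antisym z≤0 0≤z)) (zeroʳ (x - y))
    where
    d≤0 : x - y ≤ 0#
    d≤0 = x≤y ∘ 0<y-x⇒x<y

    0<dz : 0# < (x - y) * z
    0<dz = <.<-respʳ-≈ (trans (+-congˡ (-‿distribˡ-* y z)) (sym (distribʳ z x (- y))))
      (x<y⇒0<y-x yz<xz)

    ≉0 : ∀ {w} → (x - y) * z ≈ w → ¬ (w ≈ 0#)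
    ≉0 dz≈w w≈0 = <.irrefl (sym (trans dz≈w w≈0)) 0<dz

    d≮0 : 0# < z → 0# ≤ x - y
    d≮0 0<z d<0 = <.asym 0<dz
      (0<y-x⇒x<y (<.<-respʳ-≈ (trans (sym (-‿distribˡ-* _ z)) (sym (+-identityˡ _)))
        (*-pos (x<0⇒0<-x d<0) 0<z)))

    z≤0 : z ≤ 0#
    z≤0 0<z = ≉0 (*-congʳ (≤-antisym d≤0 (d≮0 0<z))) (zeroˡ z)

  *-mono-≤ : ∀ {w x y z} → 0# ≤ x → 0# ≤ y → w ≤ x → y ≤ z → w * y ≤ x * z
  *-mono-≤ {w} {x} {y} {z} 0≤x 0≤y w≤x y≤z = begin
    w * y ≲⟨ *-monoˡ-≤ 0≤y w≤x ⟩
    x * y ≈⟨ *-comm x y ⟩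
    y * x ≲⟨ *-monoˡ-≤ 0≤x y≤z ⟩
    z * x ≈⟨ *-comm z x ⟩
    x * z ∎

  0≤x*y : ∀ {x y} → 0# ≤ x → 0# ≤ y → 0# ≤ x * y
  0≤x*y {x} {y} 0≤x 0≤y = begin
    0#     ≈⟨ zeroˡ y ⟨
    0# * y ≲⟨ *-monoˡ-≤ 0≤y 0≤x ⟩
    x * y  ∎

  -- A negative square excludes `x < 0#`, since `- x * - x` would be positive; but then `x` is
  -- non-negative and so is its square.
  0≤x*x : ∀ {x} → 0# ≤ x * x
  0≤x*x {x} xx<0 = 0≤x*y 0≤x 0≤x xx<0
    where
    -x*-x≈x*x : - x * - x ≈ x * x
    -x*-x≈x*x = trans (sym (-‿distribˡ-* x (- x)))
      (trans (-‿cong (sym (-‿distribʳ-* x x))) (-‿involutive (x * x)))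

    0≤x : 0# ≤ x
    0≤x x<0 = <.asym xx<0 (<.<-respʳ-≈ -x*-x≈x*x (*-pos (x<0⇒0<-x x<0) (x<0⇒0<-x x<0)))

  0<1 : 0# < 1#
  0<1 with #⇒<⊎> 1#0
  ... | inj₂ 0<1 = 0<1
  ... | inj₁ 1<0 = contradiction (<.<-respˡ-≈ (sym (*-identityˡ 1#)) 1<0) 0≤x*x

  0≤1 : 0# ≤ 1#
  0≤1 = <.asym 0<1

  -- For `1# < x` the product `(x - 1#) * x` is positive. This gives the upper bounds for both `√`
  -- and `1# ^ p`.
  x*x≤x⇒x≤1 : ∀ {x} → x * x ≤ x → x ≤ 1#
  x*x≤x⇒x≤1 {x} xx≤x 1<x = xx≤x
    (0<y-x⇒x<y (<.<-respʳ-≈ [x-1]x≈xx-x (*-pos (x<y⇒0<y-x 1<x) (<.trans 0<1 1<x))))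
    where
    [x-1]x≈xx-x : (x - 1#) * x ≈ x * x - x
    [x-1]x≈xx-x = trans (distribʳ x x (- 1#))
      (+-congˡ (trans (sym (-‿distribˡ-* 1# x)) (-‿cong (*-identityˡ x))))

  √≤1 : ∀ {x} → 0# ≤ x → x ≤ 1# → √ x ≤ 1#
  √≤1 {x} 0≤x x≤1 1<√x = x*x≤x⇒x≤1 (begin
    √ x * √ x ≈⟨ √-square 0≤x ⟩
    x         ≲⟨ x≤1 ⟩
    1#        ≲⟨ <.asym 1<√x ⟩
    √ x       ∎) 1<√x

  -- `1# ^ p` is idempotent by multiplicativity, hence at most `1#`; monotonicity in the exponent,
  -- starting from exponent `1#`, gives the other bound.
  1^p≈1 : ∀ {p} → 1# ≤ p → 1# ^ p ≈ 1#
  1^p≈1 {p} 1≤p = ≤-antisym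
    (x*x≤x⇒x≤1 (≤-reflexive (sym (trans (^-cong (sym (*-identityˡ 1#)) refl) (^-distribʳ-* 0≤1 0≤1 1≤p)))))
    (begin
      1#      ≈⟨ ^-identityʳ 0≤1 ⟨
      1# ^ 1# ≲⟨ ^-monoʳ-≤ (≤-reflexive refl) (≤-reflexive refl) 1≤p ⟩
      1# ^ p  ∎)

  -- `0# ^ p` equals its own square, so it is non-negative; monotonicity in the base does the rest.
  0≤x^p : ∀ {x p} → 0# ≤ x → 1# ≤ p → 0# ≤ x ^ p
  0≤x^p {x} {p} 0≤x 1≤p = begin
    0#              ≲⟨ 0≤x*x ⟩
    0# ^ p * 0# ^ p ≈⟨ ^-distribʳ-* 0≤0 0≤0 1≤p ⟨
    (0# * 0#) ^ p   ≈⟨ ^-cong (zeroˡ 0#) refl ⟩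
    0# ^ p          ≲⟨ ^-monoˡ-≤ 0≤0 0≤x 1≤p ⟩
    x ^ p           ∎
    where
    0≤0 : 0# ≤ 0#
    0≤0 = ≤-reflexive refl

  -- Finite sums and products of reals.

  0≤sum : ∀ {n} (f : Fin n → ℝ) → (∀ i → 0# ≤ f i) → 0# ≤ sum f
  0≤sum {zero}  f 0≤f = ≤-reflexive refl
  0≤sum {suc n} f 0≤f = begin
    0#      ≈⟨ +-identityˡ 0# ⟨
    0# + 0# ≲⟨ +-mono-≤ (0≤f zero) (0≤sum (f ∘ suc) (0≤f ∘ suc)) ⟩
    sum f   ∎

  sum-mono-≤ : ∀ {n} {f g : Fin n → ℝ} → (∀ i → f i ≤ g i) → sum f ≤ sum g
  sum-mono-≤ {zero}  f≤g = ≤-reflexive refl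
  sum-mono-≤ {suc n} f≤g = +-mono-≤ (f≤g zero) (sum-mono-≤ (f≤g ∘ suc))

  -- Split off the term at `h zero`; by injectivity the remaining indices avoid it, so `punchOut`
  -- turns them into an injection into the remaining terms.
  sum-injection-≤ : ∀ {m n} (f : Fin n → ℝ) → (∀ i → 0# ≤ f i) →
    (h : Fin m → Fin n) → Injective _≡_ _≡_ h → sum (f ∘ h) ≤ sum f
  sum-injection-≤ {zero}          f 0≤f h h-inj = 0≤sum f 0≤f
  sum-injection-≤ {suc m} {zero}  f 0≤f h h-inj with () ← h zero
  sum-injection-≤ {suc m} {suc n} f 0≤f h h-inj = begin
    f (h zero) + sum (f ∘ h ∘ suc)
      ≡⟨ ≡.cong (f (h zero) +_) (∑.sum-cong-≗ (λ i → ≡.cong f (≡.sym (punchIn-punchOut (h₀≢ i))))) ⟩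
    f (h zero) + sum (removeAt f (h zero) ∘ h′)
      ≲⟨ +-mono-≤ (≤-reflexive refl) (sum-injection-≤ (removeAt f (h zero)) (λ i → 0≤f _) h′ h′-inj) ⟩
    f (h zero) + sum (removeAt f (h zero))
      ≈⟨ ∑.sum-remove f ⟨
    sum f ∎
    where
    h₀≢ : ∀ i → h zero ≢ h (suc i)
    h₀≢ i h₀≡ = 0≢1+n (h-inj h₀≡)

    h′ : Fin m → Fin n
    h′ i = punchOut (h₀≢ i)

    h′-inj : Injective _≡_ _≡_ h′
    h′-inj = suc-injective ∘ h-inj ∘ punchOut-injective (h₀≢ _) (h₀≢ _)

  sum-++ : ∀ m {n} (f : Fin (m ℕ.+ n) → ℝ) → sum f ≈ sum (λ i → f (i ↑ˡ n)) + sum (λ j → f (m ↑ʳ j))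
  sum-++ zero    f = sym (+-identityˡ _)
  sum-++ (suc m) f = trans (+-congˡ (sum-++ m (f ∘ suc))) (sym (+-assoc _ _ _))

  sum-combine : ∀ m {n} (f : Fin (m ℕ.* n) → ℝ) → sum f ≈ sum {m} (λ i → sum {n} (λ j → f (combine i j)))
  sum-combine zero        f = refl
  sum-combine (suc m) {n} f = trans (sum-++ n f) (+-congˡ (sum-combine m (λ z → f (n ↑ʳ z))))

  -- Expansion of the `k`-th power of a sum: `Fin (n ℕ.^ k)` enumerates the functions from `Fin k`
  -- to `Fin n`, one for each choice of a summand in every factor.
  sum-finToFun : ∀ n k (f : Fin n → ℝ) →
    sum {n ℕ.^ k} (λ z → product (λ l → f (finToFun {n} {k} z l))) ≈ product {k} (λ _ → sum f)
  sum-finToFun n zero    f = +-identityʳ 1#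
  sum-finToFun n (suc k) f = begin-equality
    sum {n ℕ.* n ℕ.^ k} g
      ≈⟨ sum-combine n g ⟩
    sum {n} (λ i → sum {n ℕ.^ k} (λ j → g (combine i j)))
      ≡⟨ ∑.sum-cong-≗ (λ i → ∑.sum-cong-≗ (λ j → ≡.cong (λ (i , j) → f i * G j) (remQuot-combine i j))) ⟩
    sum {n} (λ i → sum {n ℕ.^ k} (λ j → f i * G j))
      ≈⟨ ∑.sum-cong-≋ (λ i → *-distribˡ-sum (f i) G) ⟨
    sum {n} (λ i → f i * sum G)
      ≈⟨ *-distribʳ-sum (sum G) f ⟨
    sum f * sum G
      ≈⟨ *-congˡ (sum-finToFun n k f) ⟩
    product {suc k} (λ _ → sum f) ∎
    where
    G : Fin (n ℕ.^ k) → ℝ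
    G z = product (λ l → f (finToFun {n} {k} z l))
    g : Fin (n ℕ.^ suc k) → ℝ
    g z = product (λ l → f (finToFun {n} {suc k} z l))

  0≤product : ∀ {n} (f : Fin n → ℝ) → (∀ i → 0# ≤ f i) → 0# ≤ product f
  0≤product {zero}  f 0≤f = 0≤1
  0≤product {suc n} f 0≤f = 0≤x*y (0≤f zero) (0≤product (f ∘ suc) (0≤f ∘ suc))

  product-mono-≤ : ∀ {n} {f g : Fin n → ℝ} → (∀ i → 0# ≤ f i) → (∀ i → f i ≤ g i) →
    product f ≤ product g
  product-mono-≤ {zero}  0≤f f≤g = ≤-reflexive refl
  product-mono-≤ {suc n} {f} 0≤f f≤g =
    *-mono-≤ (≤-trans (0≤f zero) (f≤g zero)) (0≤product (f ∘ suc) (0≤f ∘ suc))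
      (f≤g zero) (product-mono-≤ (0≤f ∘ suc) (f≤g ∘ suc))

  product-^ : ∀ {n p} (f : Fin n → ℝ) → (∀ i → 0# ≤ f i) → 1# ≤ p →
    product f ^ p ≈ product (λ i → f i ^ p)
  product-^ {zero}  f 0≤f 1≤p = 1^p≈1 1≤p
  product-^ {suc n} f 0≤f 1≤p =
    trans (^-distribʳ-* (0≤f zero) (0≤product (f ∘ suc) (0≤f ∘ suc)) 1≤p)
      (*-congˡ (product-^ (f ∘ suc) (0≤f ∘ suc) 1≤p))

-- Decidable subsets and their binary codes.

module _ {n} {P : Fin n → Set} (P? : ∀ i → Dec (P i)) where

  subset : Subset n
  subset = tabulate (does ∘ P?)

  ∈-subset⁺ : ∀ {i} → P i → i ∈ subset
  ∈-subset⁺ {i} pi = lookup⇒[]= i subset (≡.trans (lookup∘tabulate (does ∘ P?) i) (dec-true (P? i) pi))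

  ∈-subset⁻ : ∀ {i} → i ∈ subset → P i
  ∈-subset⁻ {i} i∈ with P? i | ≡.trans (≡.sym (lookup∘tabulate (does ∘ P?) i)) ([]=⇒lookup i∈)
  ... | yes pi | _ = pi

combine-monoʳ-≤ : ∀ {m n} (i : Fin m) {j k : Fin n} → j Fin.≤ k → combine i j Fin.≤ combine i k
combine-monoʳ-≤ i {j} {k} j≤k =
  ≡.subst₂ ℕ._≤_ (≡.sym (toℕ-combine i j)) (≡.sym (toℕ-combine i k)) (ℕ.+-monoʳ-≤ _ j≤k)

from-injective : ∀ {A B : Set} (f : A ↔ B) {x y} → Inverse.from f x ≡ Inverse.from f y → x ≡ y
from-injective f = Injection.injective (↔⇒↣ (↔-sym f))

bit : Bool → Fin 2
bit = Inverse.from 2↔Bool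

-- Binary notation with the head as leading digit: an injective numbering of subsets that also
-- respects inclusion.
encode : ∀ {n} → Subset n → Fin (2 ℕ.^ n)
encode []      = zero
encode (b ∷ p) = combine (bit b) (encode p)

encode-injective : ∀ {n} {p q : Subset n} → encode p ≡ encode q → p ≡ q
encode-injective {p = []}    {[]}    _  = ≡.refl
encode-injective {p = b ∷ p} {c ∷ q} eq
  with b≡c , p≡q ← combine-injective (bit b) (encode p) (bit c) (encode q) eq =
  ≡.cong₂ _∷_ (from-injective 2↔Bool b≡c) (encode-injective p≡q)

-- A larger leading digit wins whatever follows, and equal leading digits leave the tails to
-- compare; inclusion excludes `true` against `false`.
encode-mono : ∀ {n} {p q : Subset n} → p ⊆ q → encode p Fin.≤ encode q
encode-mono {p = []}        {[]}        p⊆q = ℕ.≤-refl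
encode-mono {p = b ∷ p}     {c ∷ q}     p⊆q with b | c
... | false | true  = ℕ.<⇒≤ (combine-monoˡ-< {i = bit false} {bit true} (encode p) (encode q) (ℕ.s≤s ℕ.z≤n))
... | true  | false = contradiction (p⊆q here) λ ()
... | false | false = combine-monoʳ-≤ (bit false) (encode-mono (drop-∷-⊆ p⊆q))
... | true  | true  = combine-monoʳ-≤ (bit true) (encode-mono (drop-∷-⊆ p⊆q))

-- Finite boxes of tuples.

bounded : ∀ {n} (f : Fin n → ℕ) → ∃[ N ] (∀ i → f i ℕ.< N)
bounded {zero}  f = 0 , λ ()
bounded {suc n} f with N , f<N ← bounded (f ∘ suc) = suc (f zero) ℕ.⊔ N , λ where
  zero    → ℕ.m≤m⊔n (suc (f zero)) N
  (suc i) → ℕ.≤-trans (f<N i) (ℕ.m≤n⊔m (suc (f zero)) N)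

-- Enumerates the cube of tuples with entries below `N`, both for summing over it and for searching
-- in it.
boxTuple : ∀ N {k} → Fin (N ℕ.^ k) → Vec ℕ k
boxTuple N z = tabulate (toℕ ∘ finToFun z)

boxTuple-surjective : ∀ {N k} (𝐢 : Vec ℕ k) → (∀ l → lookup 𝐢 l ℕ.< N) → ∃[ z ] boxTuple N z ≡ 𝐢
boxTuple-surjective {N} {k} 𝐢 𝐢<N = funToFin f , (begin
  tabulate (toℕ ∘ finToFun (funToFin f)) ≡⟨ tabulate-cong (≡.cong toℕ ∘ finToFun-funToFin f) ⟩
  tabulate (toℕ ∘ f)                     ≡⟨ tabulate-cong (λ l → toℕ-fromℕ< (𝐢<N l)) ⟩
  tabulate (lookup 𝐢)                    ≡⟨ tabulate∘lookup 𝐢 ⟩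
  𝐢                                      ∎)
  where
  open ≡.≡-Reasoning
  f : Fin k → Fin N
  f l = fromℕ< (𝐢<N l)

-- Refinement of level sets and its rank.

-- 𝐢 ⊑ 𝐣: the partition of the positions into the level sets of 𝐢 refines that of 𝐣.
infix 4 _⊑_
_⊑_ : ∀ {k} → Vec ℕ k → Vec ℕ k → Set
𝐢 ⊑ 𝐣 = ∀ l m → lookup 𝐢 l ≡ lookup 𝐢 m → lookup 𝐣 l ≡ lookup 𝐣 m

module _ {k} (𝐢 : Vec ℕ k) where

  private
    related? : ∀ z → Dec (lookup 𝐢 (quotient k z) ≡ lookup 𝐢 (remainder {k} k z))
    related? z = lookup 𝐢 (quotient k z) ℕ.≟ lookup 𝐢 (remainder {k} k z)

  -- The equivalence relation "equal entries" as a set of pairs of positions, each pair coded by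
  -- `combine`; `⊑` becomes inclusion of kernels.
  kernel : Subset (k ℕ.* k)
  kernel = subset related?

  ∈-kernel⁺ : ∀ {l m} → lookup 𝐢 l ≡ lookup 𝐢 m → combine l m ∈ kernel
  ∈-kernel⁺ {l} {m} eq = ∈-subset⁺ related?
    (≡.subst (λ (l , m) → lookup 𝐢 l ≡ lookup 𝐢 m) (≡.sym (remQuot-combine l m)) eq)

  ∈-kernel⁻ : ∀ {l m} → combine l m ∈ kernel → lookup 𝐢 l ≡ lookup 𝐢 m
  ∈-kernel⁻ {l} {m} lm∈ =
    ≡.subst (λ (l , m) → lookup 𝐢 l ≡ lookup 𝐢 m) (remQuot-combine l m) (∈-subset⁻ related? lm∈)

  -- A linear extension of ⊑.
  rank : ℕ
  rank = toℕ (encode kernel)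

rank-mono : ∀ {k} (𝐢 𝐣 : Vec ℕ k) → 𝐢 ⊑ 𝐣 → rank 𝐢 ℕ.≤ rank 𝐣
rank-mono {k} 𝐢 𝐣 𝐢⊑𝐣 = encode-mono λ {z} z∈ →
  ≡.subst (_∈ kernel 𝐣) (combine-remQuot {k} k z)
    (∈-kernel⁺ 𝐣 (𝐢⊑𝐣 _ _ (∈-kernel⁻ 𝐢 (≡.subst (_∈ kernel 𝐢) (≡.sym (combine-remQuot {k} k z)) z∈))))

-- Since `encode` is injective, equal ranks mean equal kernels; so `rank` separates the classes of
-- tuples with the same level sets.
rank≡⇒⊑ : ∀ {k} (𝐢 𝐣 : Vec ℕ k) → rank 𝐢 ≡ rank 𝐣 → 𝐢 ⊑ 𝐣
rank≡⇒⊑ 𝐢 𝐣 eq l m 𝐢≡ = ∈-kernel⁻ 𝐣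
  (≡.subst (combine l m ∈_) (encode-injective (toℕ-injective eq)) (∈-kernel⁺ 𝐢 𝐢≡))

-- Finitary permutations of ℕ and their orbits on tuples.

_∘S∞_ : S∞ → S∞ → S∞
σ ∘S∞ τ = record
  { permutation   = S∞.permutation σ ↔-∘ S∞.permutation τ
  ; finiteSupport = proj₁ (S∞.finiteSupport τ) ++ proj₁ (S∞.finiteSupport σ) , λ n n∉ →
      ≡.trans (≡.cong (S∞.to σ) (proj₂ (S∞.finiteSupport τ) n (n∉ ∘ ∈-++⁺ˡ)))
        (proj₂ (S∞.finiteSupport σ) n (n∉ ∘ ∈-++⁺ʳ (proj₁ (S∞.finiteSupport τ))))
  }

idS∞ : S∞
idS∞ = record { permutation = ↔-id ℕ ; finiteSupport = [] , λ _ _ → ≡.refl }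

swap : ℕ → ℕ → ℕ → ℕ
swap i j n with n ℕ.≟ i
... | yes _ = j
... | no  _ with n ℕ.≟ j
...   | yes _ = i
...   | no  _ = n

swap-fixes : ∀ {i j n} → n ≢ i → n ≢ j → swap i j n ≡ n
swap-fixes {i} {j} {n} n≢i n≢j with n ℕ.≟ i
... | yes n≡i = contradiction n≡i n≢i
... | no  _ with n ℕ.≟ j
...   | yes n≡j = contradiction n≡j n≢j
...   | no  _   = ≡.refl

swap-left : ∀ i j → swap i j i ≡ j
swap-left i j with i ℕ.≟ i
... | yes _  = ≡.refl
... | no i≢i = contradiction ≡.refl i≢i

swap-right : ∀ i j → swap i j j ≡ i
swap-right i j with j ℕ.≟ i
... | yes j≡i = j≡i
... | no  _ with j ℕ.≟ j
...   | yes _  = ≡.refl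
...   | no j≢j = contradiction ≡.refl j≢j

swap-involutive : ∀ i j n → swap i j (swap i j n) ≡ n
swap-involutive i j n with n ℕ.≟ i
... | yes n≡i = ≡.trans (swap-right i j) (≡.sym n≡i)
... | no n≢i with n ℕ.≟ j
...   | yes n≡j = ≡.trans (swap-left i j) (≡.sym n≡j)
...   | no n≢j  = swap-fixes n≢i n≢j

transposition : ℕ → ℕ → S∞
transposition i j = record
  { permutation   = mk↔ₛ′ (swap i j) (swap i j) (swap-involutive i j) (swap-involutive i j)
  ; finiteSupport = i ∷ j ∷ [] , λ n n∉ → swap-fixes (n∉ ∘ here) (n∉ ∘ there ∘ here)
  }

lookup-ext : ∀ {a} {A : Set a} {n} {xs ys : Vec A n} → (∀ i → lookup xs i ≡ lookup ys i) → xs ≡ ys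
lookup-ext {xs = xs} {ys} eq =
  ≡.trans (≡.sym (tabulate∘lookup xs)) (≡.trans (tabulate-cong eq) (tabulate∘lookup ys))

-- Match the tails, then transpose the image of i with j: this fixes the
-- entries of 𝐣, unless j is one of them, and then the image of i is already j.
orbit : ∀ {k} (𝐢 𝐣 : Vec ℕ k) → 𝐢 ⊑ 𝐣 → 𝐣 ⊑ 𝐢 → ∃[ σ ] Vec.map (S∞.from σ) 𝐢 ≡ 𝐣
orbit []      []      _   _   = idS∞ , ≡.refl
orbit (i ∷ 𝐢) (j ∷ 𝐣) 𝐢⊑𝐣 𝐣⊑𝐢
  with σ , eq ← orbit 𝐢 𝐣 (λ l m → 𝐢⊑𝐣 (suc l) (suc m)) (λ l m → 𝐣⊑𝐢 (suc l) (suc m)) =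
  -- Inverting reverses the composition: `from` of this product applies `S∞.from σ` first and the
  -- transposition afterwards.
  σ ∘S∞ transposition (S∞.from σ i) j ,
  ≡.cong₂ _∷_ (swap-left (S∞.from σ i) j) (lookup-ext λ l → begin
    lookup (Vec.map (τ ∘ S∞.from σ) 𝐢) l   ≡⟨ lookup-map l _ 𝐢 ⟩
    τ (S∞.from σ (lookup 𝐢 l))             ≡⟨ ≡.cong τ (σ𝐢≡𝐣 l) ⟩
    τ (lookup 𝐣 l)                         ≡⟨ τ-fixes l ⟩
    lookup 𝐣 l                             ∎)
  where
  open ≡.≡-Reasoning
  τ : ℕ → ℕ
  τ = swap (S∞.from σ i) j

  σ𝐢≡𝐣 : ∀ l → S∞.from σ (lookup 𝐢 l) ≡ lookup 𝐣 l
  σ𝐢≡𝐣 l = ≡.trans (≡.sym (lookup-map l _ 𝐢)) (≡.cong (λ 𝐱 → lookup 𝐱 l) eq)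

  τ-fixes : ∀ l → τ (lookup 𝐣 l) ≡ lookup 𝐣 l
  τ-fixes l with lookup 𝐣 l ℕ.≟ j
  ... | yes 𝐣ₗ≡j = begin
    τ (lookup 𝐣 l) ≡⟨ ≡.cong τ 𝐣ₗ≡j ⟩
    τ j            ≡⟨ swap-right (S∞.from σ i) j ⟩
    S∞.from σ i    ≡⟨ ≡.cong (S∞.from σ) (𝐣⊑𝐢 zero (suc l) (≡.sym 𝐣ₗ≡j)) ⟩
    S∞.from σ (lookup 𝐢 l) ≡⟨ σ𝐢≡𝐣 l ⟩
    lookup 𝐣 l     ∎
  -- If this entry were the image of `i`, injectivity would give `lookup 𝐢 l ≡ i`, and `𝐢⊑𝐣` would
  -- make the entry equal to `j`.
  ... | no 𝐣ₗ≢j = swap-fixes (λ 𝐣ₗ≡σi → 𝐣ₗ≢j (𝐢⊑𝐣 (suc l) zero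
    (from-injective (S∞.permutation σ) (≡.trans (σ𝐢≡𝐣 l) 𝐣ₗ≡σi)))) 𝐣ₗ≢j

-- Set partitions and level sets of tuples.

module _ {k} (π : SetPartition k) where
  open SetPartition π

  -- Labels each position by the code of its block, which yields a tuple whose level sets are the
  -- blocks of `π`. The labels are below `2 ℕ.^ k`, so all representatives lie in one finite box.
  representative : Vec ℕ k
  representative = tabulate (toℕ ∘ encode ∘ proj₁ ∘ covers)

  representative< : ∀ l → lookup representative l ℕ.< 2 ℕ.^ k
  representative< l = ≡.subst (ℕ._< 2 ℕ.^ k) (≡.sym (lookup∘tabulate _ l)) (toℕ<n _)

  sameBlock⇒≡ : ∀ {l m} → SameBlock l m → lookup representative l ≡ lookup representative m
  sameBlock⇒≡ {l} {m} (B , block , l∈B , m∈B) = begin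
    lookup representative l          ≡⟨ lookup∘tabulate _ l ⟩
    toℕ (encode (proj₁ (covers l)))  ≡⟨ ≡.cong (toℕ ∘ encode) (≡.trans (blockOf l∈B) (≡.sym (blockOf m∈B))) ⟩
    toℕ (encode (proj₁ (covers m)))  ≡⟨ lookup∘tabulate _ m ⟨
    lookup representative m          ∎
    where
    open ≡.≡-Reasoning
    blockOf : ∀ {x} → x ∈ B → proj₁ (covers x) ≡ B
    blockOf {x} = disjoint (proj₁ (proj₂ (covers x))) block (proj₂ (proj₂ (covers x)))

  ≡⇒sameBlock : ∀ {l m} → lookup representative l ≡ lookup representative m → SameBlock l m
  ≡⇒sameBlock {l} {m} eq = proj₁ (covers l) , proj₁ (proj₂ (covers l)) , proj₂ (proj₂ (covers l)) ,
    ≡.subst (m ∈_) (≡.sym (encode-injective (toℕ-injective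
      (≡.trans (≡.sym (lookup∘tabulate _ l)) (≡.trans eq (lookup∘tabulate _ m))))))
      (proj₂ (proj₂ (covers m)))

-- The block `C` of `ρ` through a point of `B` is `B` itself: each of the two refinements gives one
-- inclusion.
block⊆ : ∀ {k} (π ρ : SetPartition k) → representative π ⊑ representative ρ →
  representative ρ ⊑ representative π → ∀ {B} → SetPartition.Block π B → SetPartition.Block ρ B
block⊆ π ρ π⊑ρ ρ⊑π {B} πB with x , x∈B ← SetPartition.nonempty π πB
  with C , ρC , x∈C ← SetPartition.covers ρ x =
  ≡.subst (SetPartition.Block ρ) (⊆-antisym C⊆B B⊆C) ρC
  where
  B⊆C : B ⊆ C
  B⊆C {y} y∈B with D , ρD , x∈D , y∈D ← ≡⇒sameBlock ρ (π⊑ρ x y (sameBlock⇒≡ π (B , πB , x∈B , y∈B)))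
    = ≡.subst (y ∈_) (SetPartition.disjoint ρ ρD ρC x∈D x∈C) y∈D
  C⊆B : C ⊆ B
  C⊆B {y} y∈C with D , πD , x∈D , y∈D ← ≡⇒sameBlock π (ρ⊑π x y (sameBlock⇒≡ ρ (C , ρC , x∈C , y∈C)))
    = ≡.subst (y ∈_) (SetPartition.disjoint π πD πB x∈D x∈B) y∈D

representative-injective : ∀ {k} (π ρ : SetPartition k) → representative π ⊑ representative ρ →
  representative ρ ⊑ representative π → ∀ B → SetPartition.isBlock π B ≡ SetPartition.isBlock ρ B
representative-injective π ρ π⊑ρ ρ⊑π B = ⇔→≡ (mk⇔
  (Equivalence.to T-≡ ∘ block⊆ π ρ π⊑ρ ρ⊑π ∘ Equivalence.from T-≡)
  (Equivalence.to T-≡ ∘ block⊆ ρ π ρ⊑π π⊑ρ ∘ Equivalence.from T-≡))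

module _ {k} (𝐢 : Vec ℕ k) where

  levelSet : Fin k → Subset k
  levelSet l = subset (λ m → lookup 𝐢 l ℕ.≟ lookup 𝐢 m)

  private
    isLevelSet? : ∀ B → Dec (∃[ l ] B ≡ levelSet l)
    isLevelSet? B = any? λ l → ≡-dec Bool._≟_ B (levelSet l)

    ∈⁺ : ∀ l {m} → lookup 𝐢 l ≡ lookup 𝐢 m → m ∈ levelSet l
    ∈⁺ l = ∈-subset⁺ (λ m → lookup 𝐢 l ℕ.≟ lookup 𝐢 m)

    ∈⁻ : ∀ l {m} → m ∈ levelSet l → lookup 𝐢 l ≡ lookup 𝐢 m
    ∈⁻ l = ∈-subset⁻ (λ m → lookup 𝐢 l ℕ.≟ lookup 𝐢 m)

  levelPartition : SetPartition k
  levelPartition = record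
    { isBlock  = λ B → ⌊ isLevelSet? B ⌋
    ; nonempty = λ B → nonempty (toWitness B)
    ; covers   = λ l → levelSet l , fromWitness (l , ≡.refl) , ∈⁺ l ≡.refl
    ; disjoint = λ B C → disjoint (toWitness B) (toWitness C)
    }
    where
    nonempty : ∀ {B} → ∃[ l ] B ≡ levelSet l → ∃[ l ] l ∈ B
    nonempty (l , ≡.refl) = l , ∈⁺ l ≡.refl
    disjoint : ∀ {B C x} → ∃[ l ] B ≡ levelSet l → ∃[ m ] C ≡ levelSet m → x ∈ B → x ∈ C → B ≡ C
    disjoint (l , ≡.refl) (m , ≡.refl) x∈B x∈C =
      -- A level set depends only on the entry at its defining position, and both entries agree with
      -- the one at `x`.
      ≡.cong (λ j → subset (λ n → j ℕ.≟ lookup 𝐢 n)) (≡.trans (∈⁻ l x∈B) (≡.sym (∈⁻ m x∈C)))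

  -- Together with `representative⊑`, this shows that every tuple has the same level sets as the
  -- representative of some set partition.
  ⊑representative : 𝐢 ⊑ representative levelPartition
  ⊑representative l m eq = sameBlock⇒≡ levelPartition {l} {m}
    (levelSet l , fromWitness (l , ≡.refl) , ∈⁺ l ≡.refl , ∈⁺ l eq)

  representative⊑ : representative levelPartition ⊑ 𝐢
  representative⊑ l m eq with B , isB , l∈B , m∈B ← ≡⇒sameBlock levelPartition {l} {m} eq
    with x , ≡.refl ← toWitness isB = ≡.trans (≡.sym (∈⁻ x l∈B)) (∈⁻ x m∈B)

-- Values of `m[ π ]` and invariance under `S∞`.

module Invariants {c ℓ₁ ℓ₂} (R : RealNumbers c ℓ₁ ℓ₂) (k : ℕ) where
  open RealNumbers R using (ℝ; 0#; 1#; Summable)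
    renaming (_≤_ to _≤ᴿ_; _^_ to _^ᴿ_)
  open Complex R
  open TensorPower R k
  private
    module ℂ = CommutativeRing ℂ-commutativeRing
    module M = Module ℂ^ℕᵏ
    module ℂ∑ = Sum ℂ.+-commutativeMonoid
    module M∑ = Sum M.+ᴹ-commutativeMonoid
  open Bases ℂ^ℕᵏ

  constantOnBlocks⇒⊑ : ∀ π 𝐢 → ConstantOnBlocks π 𝐢 → representative π ⊑ 𝐢
  constantOnBlocks⇒⊑ π 𝐢 const l m eq = const l m (≡⇒sameBlock π eq)

  ⊑⇒constantOnBlocks : ∀ π 𝐢 → representative π ⊑ 𝐢 → ConstantOnBlocks π 𝐢
  ⊑⇒constantOnBlocks π 𝐢 ⊑𝐢 l m same = ⊑𝐢 l m (sameBlock⇒≡ π same)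

  -- The incidence matrix of refinement: rows are partitions, columns are tuples, and each entry
  -- comes with the reason for its value.
  data Value (π : SetPartition k) (𝐢 : Vec ℕ k) : Set c where
    one  : representative π ⊑ 𝐢     → m[ π ] 𝐢 ≡ 1ᶜ → Value π 𝐢
    none : ¬ (representative π ⊑ 𝐢) → m[ π ] 𝐢 ≡ 0ᶜ → Value π 𝐢

  value : ∀ π 𝐢 → Value π 𝐢
  value π 𝐢 = decide (constantOnBlocks? π 𝐢) ≡.refl
    where
    decide : (d : Dec (ConstantOnBlocks π 𝐢)) → m[ π ] 𝐢 ≡ (if does d then 1ᶜ else 0ᶜ) → Value π 𝐢
    decide (yes const) = one (constantOnBlocks⇒⊑ π 𝐢 const)
    decide (no ¬const) = none (¬const ∘ ⊑⇒constantOnBlocks π 𝐢)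

  -- The combinatorial form of `S∞`-invariance. `orbit` gives one direction of the equivalence; the
  -- other holds because an injective relabelling keeps the level sets.
  KernelInvariant : Carrierᴹ → Set _
  KernelInvariant a = ∀ 𝐢 𝐣 → 𝐢 ⊑ 𝐣 → 𝐣 ⊑ 𝐢 → a 𝐢 ≈ᶜ a 𝐣

  m-kernelInvariant : ∀ π → KernelInvariant m[ π ]
  m-kernelInvariant π 𝐢 𝐣 𝐢⊑𝐣 𝐣⊑𝐢 = ℂ.reflexive (≡.cong (if_then 1ᶜ else 0ᶜ)
    (does-⇔ (mk⇔ (λ const l m → 𝐢⊑𝐣 l m ∘ const l m) (λ const l m → 𝐣⊑𝐢 l m ∘ const l m))
      (constantOnBlocks? π 𝐢) (constantOnBlocks? π 𝐣)))

  S∞-invariant⇒kernelInvariant : ∀ {a} → (∀ σ → σ • a ≈ᴹ a) → KernelInvariant a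
  S∞-invariant⇒kernelInvariant {a} inv 𝐢 𝐣 𝐢⊑𝐣 𝐣⊑𝐢
    with σ , ≡.refl ← orbit 𝐢 𝐣 𝐢⊑𝐣 𝐣⊑𝐢 = ℂ.sym (inv σ 𝐢)

  kernelInvariant⇒S∞-invariant : ∀ {a} → KernelInvariant a → ∀ σ → σ • a ≈ᴹ a
  kernelInvariant⇒S∞-invariant inv σ 𝐢 = inv _ 𝐢
    (λ l m eq → from-injective (S∞.permutation σ)
      (≡.trans (≡.sym (lookup-map l _ 𝐢)) (≡.trans eq (lookup-map m _ 𝐢))))
    (λ l m eq → ≡.trans (lookup-map l _ 𝐢) (≡.trans (≡.cong (S∞.from σ) eq) (≡.sym (lookup-map m _ 𝐢))))

  -- Linear independence.

  sum-apply : ∀ {n} (f : Fin n → Carrierᴹ) 𝐢 → M∑.sum f 𝐢 ≡ ℂ∑.sum (λ s → f s 𝐢)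
  sum-apply {zero}  f 𝐢 = ≡.refl
  sum-apply {suc n} f 𝐢 = ≡.cong (f zero 𝐢 +ᶜ_) (sum-apply (f ∘ suc) 𝐢)

  sum-singleton : ∀ {n} (f : Fin n → ℂ) s → (∀ t → t ≢ s → f t ≈ᶜ 0ᶜ) → ℂ∑.sum f ≈ᶜ f s
  sum-singleton {suc n} f s f≈0 = begin
    ℂ∑.sum f                          ≈⟨ ℂ∑.sum-remove f ⟩
    f s +ᶜ ℂ∑.sum (removeAt f s)      ≈⟨ ℂ.+-congˡ (ℂ∑.sum-cong-≋ (λ t → f≈0 _ (punchInᵢ≢i s t))) ⟩
    f s +ᶜ ℂ∑.sum {n} (λ _ → 0ᶜ)      ≈⟨ ℂ.+-congˡ (ℂ∑.sum-replicate-zero n) ⟩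
    f s +ᶜ 0ᶜ                         ≈⟨ ℂ.+-identityʳ (f s) ⟩
    f s                               ∎
    where open SetoidReasoning ℂ.setoid

  -- Evaluate the relation at the representative of `π s`. Any other `π t` that is non-zero there
  -- has a representative of smaller rank, so its coefficient vanishes by induction on the rank and
  -- only `κ s` survives.
  m-linearlyIndependent : LinearlyIndependent (setPartitions k) m[_]
  m-linearlyIndependent {n} π π-inj κ ∑≈0 s = go s (<-wellFounded _)
    where
    r : Fin n → Vec ℕ k
    r = representative ∘ π

    go : ∀ s → Acc ℕ._<_ (rank (r s)) → κ s ≈ᶜ 0ᶜ
    go s (acc rec) with value (π s) (r s)
    ... | none r⋢r _ = contradiction (λ _ _ eq → eq) r⋢r
    ... | one _ m≡1  = begin
      κ s                                   ≈⟨ ℂ.*-identityʳ (κ s) ⟨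
      κ s *ᶜ 1ᶜ                             ≡⟨ ≡.cong (κ s *ᶜ_) m≡1 ⟨
      κ s *ᶜ m[ π s ] (r s)                 ≈⟨ sum-singleton (λ t → κ t *ᶜ m[ π t ] (r s)) s others≈0 ⟨
      ℂ∑.sum (λ t → κ t *ᶜ m[ π t ] (r s))  ≡⟨ sum-apply (λ t → κ t M.*ₗ m[ π t ]) (r s) ⟨
      M∑.sum (λ t → κ t M.*ₗ m[ π t ]) (r s) ≈⟨ ∑≈0 (r s) ⟩
      0ᶜ                                    ∎
      where
      open SetoidReasoning ℂ.setoid
      others≈0 : ∀ t → t ≢ s → κ t *ᶜ m[ π t ] (r s) ≈ᶜ 0ᶜ
      others≈0 t t≢s with value (π t) (r s)
      ... | none _ m≡0   = ℂ.trans (ℂ.*-congˡ (ℂ.reflexive m≡0)) (ℂ.zeroʳ (κ t))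
      ... | one rₜ⊑rₛ _  = ℂ.trans
        (ℂ.*-congʳ (go t (rec (ℕ.≤∧≢⇒< (rank-mono (r t) (r s) rₜ⊑rₛ) rank≢))))
        (ℂ.zeroˡ _)
        where
        rank≢ : rank (r t) ≢ rank (r s)
        -- Equal ranks would give refinement both ways, hence equal partitions, against the
        -- distinctness of the indices.
        rank≢ eq = t≢s (π-inj (representative-injective (π t) (π s) rₜ⊑rₛ (rank≡⇒⊑ (r s) (r t) (≡.sym eq))))

  -- Spanning, by elimination in order of increasing rank.

  private
    InSpan : Carrierᴹ → Set _
    InSpan = Span (setPartitions k) m[_]

  span-step : ∀ {a} κ π → InSpan (a M.+ᴹ M.-ᴹ (κ M.*ₗ m[ π ])) → InSpan a
  span-step {a} κ π (n , ρ , λs , eq) = suc n , (π ∷ᶠ ρ) , (κ ∷ᶠ λs) , λ 𝐢 →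
    let b = κ *ᶜ m[ π ] 𝐢 in begin
    a 𝐢                     ≈⟨ ℂ.+-identityʳ (a 𝐢) ⟨
    a 𝐢 +ᶜ 0ᶜ               ≈⟨ ℂ.+-congˡ (ℂ.-‿inverseˡ b) ⟨
    a 𝐢 +ᶜ (-ᶜ b +ᶜ b)      ≈⟨ ℂ.+-assoc (a 𝐢) (-ᶜ b) b ⟨
    (a 𝐢 +ᶜ -ᶜ b) +ᶜ b      ≈⟨ ℂ.+-congʳ (eq 𝐢) ⟩
    M∑.sum (λ s → λs s M.*ₗ m[ ρ s ]) 𝐢 +ᶜ b ≈⟨ ℂ.+-comm _ b ⟩
    b +ᶜ M∑.sum (λ s → λs s M.*ₗ m[ ρ s ]) 𝐢 ∎
    where open SetoidReasoning ℂ.setoid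

  VanishesBelow : ℕ → Carrierᴹ → Set _
  VanishesBelow r a = ∀ 𝐢 → rank 𝐢 ℕ.< r → a 𝐢 ≈ᶜ 0ᶜ

  -- Every rank that occurs at all occurs in one finite box, so whether a given rank occurs can be
  -- decided by search.
  canonical : ∀ (𝐢 : Vec ℕ k) → ∃[ z ] rank (boxTuple (2 ℕ.^ k) {k} z) ≡ rank 𝐢
  canonical 𝐢 = proj₁ box , ≡.trans (≡.cong rank (proj₂ box))
    (ℕ.≤-antisym (rank-mono 𝐣 𝐢 (representative⊑ 𝐢)) (rank-mono 𝐢 𝐣 (⊑representative 𝐢)))
    where
    𝐣 : Vec ℕ k
    𝐣 = representative (levelPartition 𝐢)

    box : ∃[ z ] boxTuple (2 ℕ.^ k) z ≡ 𝐣
    box = boxTuple-surjective 𝐣 (representative< (levelPartition 𝐢))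

  -- Subtracting a 𝐣 times m of the level partition of 𝐣 kills the value of a
  -- on the orbit of 𝐣 and changes no value at tuples of smaller rank.
  kernelInvariant⇒inSpan : ∀ n r → r ℕ.+ n ≡ 2 ℕ.^ (k ℕ.* k) → ∀ {a} →
    KernelInvariant a → VanishesBelow r a → InSpan a
  -- `n` counts the ranks still to be treated; at `n = 0` the bound `r` exceeds every rank, so `a`
  -- is zero and the empty combination serves.
  kernelInvariant⇒inSpan zero r r≡ inv a≈0 = 0 , (λ ()) , (λ ()) , λ 𝐢 →
    a≈0 𝐢 (≡.subst (rank 𝐢 ℕ.<_) (≡.trans (≡.sym r≡) (ℕ.+-identityʳ r)) (toℕ<n _))
  kernelInvariant⇒inSpan (suc n) r r≡ {a} inv a≈0
    with any? (λ z → rank (boxTuple (2 ℕ.^ k) {k} z) ℕ.≟ r)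
  -- By `canonical`, no tuple whatsoever has rank `r`, so `a` already vanishes one rank further.
  ... | no ∄ = kernelInvariant⇒inSpan n (suc r) (≡.trans (≡.sym (ℕ.+-suc r n)) r≡) inv λ 𝐢 r𝐢<1+r →
    a≈0 𝐢 (ℕ.≤∧≢⇒< (ℕ.s≤s⁻¹ r𝐢<1+r) λ r𝐢≡r → ∄ (proj₁ (canonical 𝐢) , ≡.trans (proj₂ (canonical 𝐢)) r𝐢≡r))
  ... | yes (z , ≡.refl) = span-step (a 𝐣) π
    (kernelInvariant⇒inSpan n (suc r) (≡.trans (≡.sym (ℕ.+-suc r n)) r≡) inv′ a′≈0)
    where
    𝐣 = boxTuple (2 ℕ.^ k) {k} z
    π = levelPartition 𝐣
    a′ = a M.+ᴹ M.-ᴹ (a 𝐣 M.*ₗ m[ π ])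

    inv′ : KernelInvariant a′
    inv′ 𝐡 𝐢 𝐡⊑𝐢 𝐢⊑𝐡 = ℂ.+-cong (inv 𝐡 𝐢 𝐡⊑𝐢 𝐢⊑𝐡) (ℂ.-‿cong (ℂ.*-congˡ (m-kernelInvariant π 𝐡 𝐢 𝐡⊑𝐢 𝐢⊑𝐡)))

    open SetoidReasoning ℂ.setoid

    a′≈0 : VanishesBelow (suc (rank 𝐣)) a′
    a′≈0 𝐢 r𝐢<1+r with value π 𝐢
    ... | one π⊑𝐢 m≡1 = begin
      a 𝐢 +ᶜ -ᶜ (a 𝐣 *ᶜ m[ π ] 𝐢) ≡⟨ ≡.cong (λ x → a 𝐢 +ᶜ -ᶜ (a 𝐣 *ᶜ x)) m≡1 ⟩
      a 𝐢 +ᶜ -ᶜ (a 𝐣 *ᶜ 1ᶜ)       ≈⟨ ℂ.+-cong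
        (inv 𝐢 𝐣 (rank≡⇒⊑ 𝐢 𝐣 r𝐢≡r) 𝐣⊑𝐢)
        (ℂ.-‿cong (ℂ.*-identityʳ (a 𝐣))) ⟩
      a 𝐣 +ᶜ -ᶜ a 𝐣               ≈⟨ ℂ.-‿inverseʳ (a 𝐣) ⟩
      0ᶜ                          ∎
      where
      𝐣⊑𝐢 : 𝐣 ⊑ 𝐢
      𝐣⊑𝐢 l m = π⊑𝐢 l m ∘ ⊑representative 𝐣 l m
      -- The upper bound on the rank of `𝐢` meets monotonicity, which places `𝐢` in the orbit of
      -- `𝐣`.
      r𝐢≡r : rank 𝐢 ≡ rank 𝐣
      r𝐢≡r = ℕ.≤-antisym (ℕ.s≤s⁻¹ r𝐢<1+r) (rank-mono 𝐣 𝐢 𝐣⊑𝐢)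
    ... | none π⋢𝐢 m≡0 = begin
      a 𝐢 +ᶜ -ᶜ (a 𝐣 *ᶜ m[ π ] 𝐢) ≡⟨ ≡.cong (λ x → a 𝐢 +ᶜ -ᶜ (a 𝐣 *ᶜ x)) m≡0 ⟩
      a 𝐢 +ᶜ -ᶜ (a 𝐣 *ᶜ 0ᶜ)       ≈⟨ ℂ.+-cong
        (a≈0 𝐢 (ℕ.≤∧≢⇒< (ℕ.s≤s⁻¹ r𝐢<1+r) r𝐢≢r))
        (ℂ.-‿cong (ℂ.zeroʳ (a 𝐣))) ⟩
      0ᶜ +ᶜ -ᶜ 0ᶜ                 ≈⟨ ℂ.-‿inverseʳ 0ᶜ ⟩
      0ᶜ                          ∎
      where
      r𝐢≢r : rank 𝐢 ≢ rank 𝐣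
      -- At equal rank `𝐣 ⊑ 𝐢` would hold, and with it `representative π ⊑ 𝐢`.
      r𝐢≢r eq = π⋢𝐢 (λ l m →
        rank≡⇒⊑ 𝐣 𝐢 (≡.sym eq) l m ∘ representative⊑ 𝐣 l m)

  -- Integrability of `m[ π ]`.

  module _ {p : ℝ} (1≤p : 1# ≤ᴿ p) {μ : ℕ → ℝ} (0≤μ : ∀ i → 0# ≤ᴿ μ i) where
    open RealNumbers R using (sum; product; _*_; _+_)
    private module ℝ where
      open RealNumbers R public
      open RealProperties R public
    open PreorderReasoning ℝ.≤-preorder

    private
      ν : ℕ → ℝ
      ν i = μ i ^ᴿ p

      0≤ν : ∀ i → 0# ≤ᴿ ν i
      0≤ν i = ℝ.0≤x^p (0≤μ i) 1≤p

      νᵏ : Vec ℕ k → ℝ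
      νᵏ 𝐢 = product (λ l → ν (lookup 𝐢 l))

      0≤νᵏ : ∀ 𝐢 → 0# ≤ᴿ νᵏ 𝐢
      0≤νᵏ 𝐢 = ℝ.0≤product _ (λ l → 0≤ν (lookup 𝐢 l))

    -- Finitely many tuples lie in a box, over which the sum is a k-th power.
    νᵏ-summable : Summable ν → Summable νᵏ
    νᵏ-summable (B , ∑ν≤B) = product {k} (λ _ → B) , bound
      where
      bound : ∀ {n} (x : Fin n → Vec ℕ k) → Injective _≡_ _≡_ x → sum (νᵏ ∘ x) ≤ᴿ product {k} (λ _ → B)
      bound {n} x x-inj = begin
        sum (νᵏ ∘ x)
          ≡⟨ ℝ∑.sum-cong-≗ (λ s → ≡.cong νᵏ (≡.sym (h-section s))) ⟩
        sum (νᵏ ∘ boxTuple N ∘ h)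
          ≲⟨ ℝ.sum-injection-≤ (νᵏ ∘ boxTuple N) (0≤νᵏ ∘ boxTuple N) h h-injective ⟩
        sum {N ℕ.^ k} (νᵏ ∘ boxTuple N)
          ≡⟨ ℝ∑.sum-cong-≗ {N ℕ.^ k} (λ z → ℝ∏.sum-cong-≗ {k} (λ l →
               ≡.cong ν (lookup∘tabulate (toℕ ∘ finToFun {N} {k} z) l))) ⟩
        sum {N ℕ.^ k} (λ z → product {k} (λ l → ν (toℕ (finToFun {N} {k} z l))))
          ≈⟨ ℝ.sum-finToFun N k (ν ∘ toℕ) ⟩
        product {k} (λ _ → sum {N} (ν ∘ toℕ))
          ≲⟨ ℝ.product-mono-≤ {k}
               (λ _ → ℝ.0≤sum {N} (ν ∘ toℕ) (0≤ν ∘ toℕ)) (λ _ → ∑ν≤B {N} toℕ toℕ-injective) ⟩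
        product {k} (λ _ → B) ∎
        where
        module ℝ∑ = Sum ℝ.+-commutativeMonoid
        module ℝ∏ = Sum ℝ.*-commutativeMonoid

        rowBound : ∀ s → ∃[ N ] (∀ l → lookup (x s) l ℕ.< N)
        rowBound s = bounded (lookup (x s))

        N : ℕ
        N = proj₁ (bounded (proj₁ ∘ rowBound))

        x<N : ∀ s l → lookup (x s) l ℕ.< N
        x<N s l = ℕ.<-trans (proj₂ (rowBound s) l) (proj₂ (bounded (proj₁ ∘ rowBound)) s)

        h : Fin n → Fin (N ℕ.^ k)
        h s = proj₁ (boxTuple-surjective (x s) (x<N s))

        h-section : ∀ s → boxTuple N (h s) ≡ x s
        h-section s = proj₂ (boxTuple-surjective (x s) (x<N s))

        h-injective : Injective _≡_ _≡_ h
        h-injective {s} {t} eq = x-inj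
          (≡.trans (≡.sym (h-section s)) (≡.trans (≡.cong (boxTuple N) eq) (h-section t)))

    -- The total mass is finite by `νᵏ-summable`, and since `product-^` turns the power of the
    -- product weight into `νᵏ`, each term is dominated by `νᵏ`.
    Lᵖ-bounded : Summable ν → ∀ {a} → (∀ 𝐢 → ∣ a 𝐢 ∣ ≤ᴿ 1#) → (∀ 𝐢 → 0# ≤ᴿ ∣ a 𝐢 ∣) → Lᵖ p μ a
    Lᵖ-bounded summable {a} ∣a∣≤1 0≤∣a∣ with B , ∑≤B ← νᵏ-summable summable = B , λ x x-inj →
      ℝ.≤-trans (ℝ.sum-mono-≤ (term≤ ∘ x)) (∑≤B x x-inj)
      where
      term≤ : ∀ 𝐢 → ∣ a 𝐢 ∣ ^ᴿ p * weight μ 𝐢 ^ᴿ p ≤ᴿ νᵏ 𝐢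
      term≤ 𝐢 = begin
        ∣ a 𝐢 ∣ ^ᴿ p * weight μ 𝐢 ^ᴿ p ≈⟨ ℝ.*-congˡ (ℝ.product-^ _ (0≤μ ∘ lookup 𝐢) 1≤p) ⟩
        ∣ a 𝐢 ∣ ^ᴿ p * νᵏ 𝐢           ≲⟨ ℝ.*-monoˡ-≤ (0≤νᵏ 𝐢) (ℝ.^-monoˡ-≤ (0≤∣a∣ 𝐢) (∣a∣≤1 𝐢) 1≤p) ⟩
        1# ^ᴿ p * νᵏ 𝐢                ≈⟨ ℝ.*-congʳ (ℝ.1^p≈1 1≤p) ⟩
        1# * νᵏ 𝐢                     ≈⟨ ℝ.*-identityˡ _ ⟩
        νᵏ 𝐢                          ∎


    m∈Lᵖ : Summable ν → ∀ π → Lᵖ p μ m[ π ]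
    m∈Lᵖ summable π = Lᵖ-bounded summable bound (λ 𝐢 → ℝ.√-nonNeg (0≤∣z∣² (m[ π ] 𝐢)))
      where
      0≤∣z∣² : ∀ ((x , y) : ℂ) → 0# ≤ᴿ x * x + y * y
      0≤∣z∣² (x , y) = begin
        0#            ≈⟨ ℝ.+-identityˡ 0# ⟨
        0# + 0#       ≲⟨ ℝ.+-mono-≤ ℝ.0≤x*x ℝ.0≤x*x ⟩
        x * x + y * y ∎

      bound : ∀ 𝐢 → ∣ m[ π ] 𝐢 ∣ ≤ᴿ 1#
      bound 𝐢 with value π 𝐢
      ... | one _ m≡1  = begin
        ∣ m[ π ] 𝐢 ∣ ≡⟨ ≡.cong ∣_∣ m≡1 ⟩
        ∣ 1ᶜ ∣       ≲⟨ ℝ.√≤1 (0≤∣z∣² 1ᶜ) (ℝ.≤-reflexive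
          (ℝ.trans (ℝ.+-cong (ℝ.*-identityˡ 1#) (ℝ.zeroˡ 0#)) (ℝ.+-identityʳ 1#))) ⟩
        1#           ∎
      ... | none _ m≡0 = begin
        ∣ m[ π ] 𝐢 ∣ ≡⟨ ≡.cong ∣_∣ m≡0 ⟩
        ∣ 0ᶜ ∣       ≲⟨ ℝ.√≤1 (0≤∣z∣² 0ᶜ) (begin
          0# * 0# + 0# * 0# ≈⟨ ℝ.trans (ℝ.+-cong (ℝ.zeroˡ 0#) (ℝ.zeroˡ 0#)) (ℝ.+-identityʳ 0#) ⟩
          0#                ≲⟨ ℝ.0≤1 ⟩
          1#                ∎) ⟩
        1#           ∎

proposition2 : ∀ {c ℓ₁ ℓ₂} (R : RealNumbers c ℓ₁ ℓ₂) →
    let open RealNumbers R in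
    (k : ℕ) .{{_ : NonZero k}} →
    let open TensorPower R k in
    (p : ℝ) → 1# ≤ p →
    (μ : ℕ → ℝ) → (∀ i → 0# < μ i) → Summable (λ i → μ i ^ p) →
    Bases.IsBasisOf ℂ^ℕᵏ (setPartitions k) m[_] (LᵖInvariants p μ)
proposition2 R k p 1≤p μ 0<μ summable = record
  { member = λ π →
      m∈Lᵖ 1≤p (<-asym ∘ 0<μ) summable π , kernelInvariant⇒S∞-invariant (m-kernelInvariant π)
  ; linearlyIndependent = m-linearlyIndependent
  ; spanning = λ (_ , inv) →
      -- Elimination starts at rank `0`, below which there is nothing to vanish on.
      kernelInvariant⇒inSpan _ 0 ≡.refl (S∞-invariant⇒kernelInvariant inv) λ _ ()
  }
  where
  open Invariants R k
  open IsStrictPartialOrder (RealNumbers.isStrictPartialOrder R) using () renaming (asym to <-asym)
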